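{- Let $\mathbf{s}$ be a sequence of positive integers and let $n\ge2$. Then $$P_{n-1}^{(\mathbf{s})}(x)=\sum_{\mathbf{e}\in I_{n-1}^{(\mathbf{s})}}x^{\,s_n\,\mathrm{asc}\,\mathbf{e}-\left\lfloor\frac{s_n e_{n-1}}{s_{n-1}}\right\rfloor}.$$
   Context: For a sequence $\mathbf{s}$ of positive integers and $n\ge1$, let $\mathbf{v}_i=(0,\ldots,0,s_i,s_{i+1},\ldots,s_n)\in\mathbb{R}^n$ (first $i-1$ coordinates zero) for $1\le i\le n$, and let $\Pi_n^{(\mathbf{s})}=\left\{\sum_{i=1}^n\alpha_i\mathbf{v}_i \mid 0\le\alpha_i<1\right\}$. Define $Q_n^{(\mathbf{s})}(x)=\sum_{\lambda\in\Pi_n^{(\mathbf{s})}\cap\mathbb{Z}^n}x^{\lambda_n}$ and $$P_{n-1}^{(\mathbf{s})}(x)=\frac{Q_n^{(\mathbf{s})}(x)}{1+x+\cdots+x^{s_n-1}}.$$ The $\mathbf{s}$-inversion sequences are $I_m^{(\mathbf{s})}=\{\mathbf{e}=(e_1,\ldots,e_m)\in\mathbb{Z}^m\mid 0\le e_i<s_i \text{ for } 1\le i\le m\}$. For $\mathbf{e}\in I_m^{(\mathbf{s})}$, an index $1\le i<m$ is an ascent of $\mathbf{e}$ if $\frac{e_i}{s_i}<\frac{e_{i+1}}{s_{i+1}}$, and $0$ is an ascent if $e_1>0$; $\mathrm{asc}\,\mathbf{e}$ is the number of ascents of $\mathbf{e}$. -}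

module Defs where

open import Data.Bool.Base using (if_then_else_)
open import Data.Fin.Base as Fin using (Fin; zero; suc; toℕ; fromℕ; inject₁)
import Data.Fin.Properties as Fin
open import Data.Integer.Base as ℤ using (ℤ; +_; 0ℤ; 1ℤ; +≤+; +<+)
import Data.Integer.Properties as ℤ
open import Data.List.Base as List
  using (List; []; _∷_; _++_; length; filter; allFin; upTo; applyUpTo; cartesianProductWith)
open import Data.List.Membership.Propositional using (_∈_)
open import Data.List.Membership.Propositional.Properties
  using (∈-map⁺; ∈-map⁻; ∈-upTo⁺; ∈-upTo⁻; ∈-cartesianProductWith⁺; ∈-cartesianProductWith⁻)
open import Data.List.Relation.Unary.All using ([])
open import Data.List.Relation.Unary.AllPairs using ([]; _∷_)
open import Data.List.Relation.Unary.Any using (here)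
open import Data.List.Relation.Unary.Unique.Propositional using (Unique)
import Data.List.Relation.Unary.Unique.Propositional.Properties as Unique
open import Data.Nat.Base as ℕ using (ℕ; zero; suc)
import Data.Nat.Properties as ℕ
open import Data.Product.Base using (Σ-syntax; ∃-syntax; _×_; _,_; proj₁; proj₂)
open import Data.Rational.Base as ℚ using (ℚ; 0ℚ; 1ℚ; ½; Positive; floor)
import Data.Rational.Literals as ℚ
import Data.Rational.Properties as ℚ
open import Data.Rational.Solver using (module +-*-Solver)
open import Data.Vec.Base using (Vec; []; _∷_; lookup)
import Data.Vec.Properties as Vec
import Data.Vec.Functional as Vector
open Vector using (Vector)
open import Function.Base using (_∘_)
open import Function.Bundles using (_⇔_; mk⇔; module Equivalence)
open import Level using (Level; 0ℓ; _⊔_)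
open import Relation.Binary.PropositionalEquality
  using (_≡_; _≢_; refl; sym; trans; cong; cong₂; subst)
open import Relation.Nullary.Decidable using (does)
open import Relation.Nullary.Negation using (¬_)
open import Relation.Unary using (Pred; Decidable)

private variable
  a p : Level
  A : Set a

------------------------------------------------------------------------
-- Real numbers: Cauchy sequences of rationals. Order and equality are
-- those of the limits.

record ℝ : Set where
  field
    seq    : ℕ → ℚ
    cauchy : ∀ ε → .{{Positive ε}} →
             ∃[ N ] (∀ m n → N ℕ.≤ m → N ℕ.≤ n → ℚ.∣ seq m ℚ.- seq n ∣ ℚ.≤ ε)
open ℝ

infix 4 _≃ℝ_ _≤ℝ_ _<ℝ_
infixl 6 _+ℝ_
infixl 7 _*ℝ_

_≃ℝ_ _≤ℝ_ _<ℝ_ : ℝ → ℝ → Set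
x ≃ℝ y = ∀ ε → .{{Positive ε}} →
  ∃[ N ] (∀ n → N ℕ.≤ n → ℚ.∣ seq x n ℚ.- seq y n ∣ ℚ.≤ ε)
x ≤ℝ y = ∀ ε → .{{Positive ε}} →
  ∃[ N ] (∀ n → N ℕ.≤ n → seq x n ℚ.≤ seq y n ℚ.+ ε)
x <ℝ y = ∃[ ε ] (Positive ε ×
  ∃[ N ] (∀ n → N ℕ.≤ n → seq x n ℚ.+ ε ℚ.≤ seq y n))

fromℚ : ℚ → ℝ
fromℚ q .seq _ = q
fromℚ q .cauchy ε = 0 , λ _ _ _ _ →
  ℚ.≤-trans (ℚ.≤-reflexive (cong ℚ.∣_∣ (ℚ.+-inverseʳ q))) (ℚ.<⇒≤ (ℚ.positive⁻¹ ε))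

fromℤ : ℤ → ℝ
fromℤ z = fromℚ (ℚ.fromℤ z)

0ℝ 1ℝ : ℝ
0ℝ = fromℤ 0ℤ
1ℝ = fromℤ 1ℤ

_+ℝ_ : ℝ → ℝ → ℝ
(x +ℝ y) .seq n = seq x n ℚ.+ seq y n
(x +ℝ y) .cauchy ε {{ε>0}} = Nx ℕ.⊔ Ny , λ m n N≤m N≤n → begin
    ℚ.∣ (seq x m ℚ.+ seq y m) ℚ.- (seq x n ℚ.+ seq y n) ∣
      ≡⟨ cong ℚ.∣_∣ (regroup (seq x m) (seq y m) (seq x n) (seq y n)) ⟩
    ℚ.∣ (seq x m ℚ.- seq x n) ℚ.+ (seq y m ℚ.- seq y n) ∣
      ≤⟨ ℚ.∣p+q∣≤∣p∣+∣q∣ (seq x m ℚ.- seq x n) (seq y m ℚ.- seq y n) ⟩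
    ℚ.∣ seq x m ℚ.- seq x n ∣ ℚ.+ ℚ.∣ seq y m ℚ.- seq y n ∣
      ≤⟨ ℚ.+-mono-≤ (hx m n (ℕ.m⊔n≤o⇒m≤o Nx Ny N≤m) (ℕ.m⊔n≤o⇒m≤o Nx Ny N≤n))
                    (hy m n (ℕ.m⊔n≤o⇒n≤o Nx Ny N≤m) (ℕ.m⊔n≤o⇒n≤o Nx Ny N≤n)) ⟩
    ½ ℚ.* ε ℚ.+ ½ ℚ.* ε  ≡⟨ ℚ.*-distribʳ-+ ε ½ ½ ⟨
    1ℚ ℚ.* ε             ≡⟨ ℚ.*-identityˡ ε ⟩
    ε ∎
  where
  open ℚ.≤-Reasoning
  open +-*-Solver
  instance
    δ>0 : Positive (½ ℚ.* ε)
    δ>0 = ℚ.pos*pos⇒pos ½ ε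
  Nx = proj₁ (cauchy x (½ ℚ.* ε))
  hx = proj₂ (cauchy x (½ ℚ.* ε))
  Ny = proj₁ (cauchy y (½ ℚ.* ε))
  hy = proj₂ (cauchy y (½ ℚ.* ε))
  regroup : ∀ a b c d → (a ℚ.+ b) ℚ.- (c ℚ.+ d) ≡ (a ℚ.- c) ℚ.+ (b ℚ.- d)
  regroup = solve 4 (λ a b c d → (a :+ b) :- (c :+ d) := (a :- c) :+ (b :- d)) refl

eventually-bounded : ∀ x → ∃[ B ] (Positive B × ∃[ N ] (∀ n → N ℕ.≤ n → ℚ.∣ seq x n ∣ ℚ.≤ B))
eventually-bounded x = 1ℚ ℚ.+ ℚ.∣ seq x N ∣ , B>0 , N , λ n N≤n → begin
    ℚ.∣ seq x n ∣                                 ≡⟨ cong ℚ.∣_∣ (split (seq x n) (seq x N)) ⟩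
    ℚ.∣ (seq x n ℚ.- seq x N) ℚ.+ seq x N ∣       ≤⟨ ℚ.∣p+q∣≤∣p∣+∣q∣ (seq x n ℚ.- seq x N) (seq x N) ⟩
    ℚ.∣ seq x n ℚ.- seq x N ∣ ℚ.+ ℚ.∣ seq x N ∣   ≤⟨ ℚ.+-monoˡ-≤ ℚ.∣ seq x N ∣ (h n N N≤n ℕ.≤-refl) ⟩
    1ℚ ℚ.+ ℚ.∣ seq x N ∣                          ∎
  where
  open ℚ.≤-Reasoning
  open +-*-Solver
  N = proj₁ (cauchy x 1ℚ)
  h = proj₂ (cauchy x 1ℚ)
  B>0 : Positive (1ℚ ℚ.+ ℚ.∣ seq x N ∣)
  B>0 = ℚ.pos+nonNeg⇒pos 1ℚ ℚ.∣ seq x N ∣ {{ℚ.∣-∣-nonNeg (seq x N)}}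
  split : ∀ a b → a ≡ (a ℚ.- b) ℚ.+ b
  split = solve 2 (λ a b → a := (a :- b) :+ b) refl

*-close : ∀ B C δ a b c d .{{_ : Positive δ}} →
          ℚ.∣ a ∣ ℚ.≤ B → ℚ.∣ d ∣ ℚ.≤ C → ℚ.∣ a ℚ.- c ∣ ℚ.≤ δ → ℚ.∣ b ℚ.- d ∣ ℚ.≤ δ →
          ℚ.∣ a ℚ.* b ℚ.- c ℚ.* d ∣ ℚ.≤ (B ℚ.+ C) ℚ.* δ
*-close B C δ a b c d a≤B d≤C a-c≤δ b-d≤δ = begin
    ℚ.∣ a ℚ.* b ℚ.- c ℚ.* d ∣
      ≡⟨ cong ℚ.∣_∣ (regroup a b c d) ⟩
    ℚ.∣ a ℚ.* (b ℚ.- d) ℚ.+ d ℚ.* (a ℚ.- c) ∣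
      ≤⟨ ℚ.∣p+q∣≤∣p∣+∣q∣ (a ℚ.* (b ℚ.- d)) (d ℚ.* (a ℚ.- c)) ⟩
    ℚ.∣ a ℚ.* (b ℚ.- d) ∣ ℚ.+ ℚ.∣ d ℚ.* (a ℚ.- c) ∣
      ≤⟨ ℚ.+-mono-≤ (bound B a (b ℚ.- d) a≤B b-d≤δ) (bound C d (a ℚ.- c) d≤C a-c≤δ) ⟩
    B ℚ.* δ ℚ.+ C ℚ.* δ
      ≡⟨ ℚ.*-distribʳ-+ δ B C ⟨
    (B ℚ.+ C) ℚ.* δ ∎
  where
  open ℚ.≤-Reasoning
  open +-*-Solver
  bound : ∀ B u v → ℚ.∣ u ∣ ℚ.≤ B → ℚ.∣ v ∣ ℚ.≤ δ → ℚ.∣ u ℚ.* v ∣ ℚ.≤ B ℚ.* δ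
  bound B u v u≤B v≤δ = begin
    ℚ.∣ u ℚ.* v ∣          ≡⟨ ℚ.∣p*q∣≡∣p∣*∣q∣ u v ⟩
    ℚ.∣ u ∣ ℚ.* ℚ.∣ v ∣    ≤⟨ ℚ.*-monoˡ-≤-nonNeg ℚ.∣ u ∣ {{ℚ.∣-∣-nonNeg u}} v≤δ ⟩
    ℚ.∣ u ∣ ℚ.* δ          ≤⟨ ℚ.*-monoʳ-≤-nonNeg δ {{ℚ.pos⇒nonNeg δ}} u≤B ⟩
    B ℚ.* δ                ∎
  regroup : ∀ a b c d → a ℚ.* b ℚ.- c ℚ.* d ≡ a ℚ.* (b ℚ.- d) ℚ.+ d ℚ.* (a ℚ.- c)
  regroup = solve 4 (λ a b c d → a :* b :- c :* d := a :* (b :- d) :+ d :* (a :- c)) refl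

split-tolerance : ∀ C ε → .{{Positive C}} → .{{Positive ε}} → ∃[ δ ] (Positive δ × C ℚ.* δ ≡ ε)
split-tolerance C ε = ℚ.1/ C ℚ.* ε , ℚ.pos*pos⇒pos (ℚ.1/ C) {{ℚ.1/pos⇒pos C}} ε ,
  trans (sym (ℚ.*-assoc C (ℚ.1/ C) ε))
        (trans (cong (ℚ._* ε) (ℚ.*-inverseʳ C)) (ℚ.*-identityˡ ε))
  where
  instance
    C≢0 : ℚ.NonZero C
    C≢0 = ℚ.pos⇒nonZero C

_*ℝ_ : ℝ → ℝ → ℝ
(x *ℝ y) .seq n = seq x n ℚ.* seq y n
(x *ℝ y) .cauchy ε =
  let Bx , Bx>0 , Mx , bx = eventually-bounded x
      By , By>0 , My , by = eventually-bounded y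
      δ , δ>0 , eq = split-tolerance (Bx ℚ.+ By) ε {{ℚ.pos+pos⇒pos Bx {{Bx>0}} By {{By>0}}}}
      Nx , hx = cauchy x δ {{δ>0}}
      Ny , hy = cauchy y δ {{δ>0}}
  in (Mx ℕ.⊔ My) ℕ.⊔ (Nx ℕ.⊔ Ny) , λ m n m≥ n≥ →
    let m≥M = ℕ.m⊔n≤o⇒m≤o (Mx ℕ.⊔ My) (Nx ℕ.⊔ Ny) m≥
        n≥M = ℕ.m⊔n≤o⇒m≤o (Mx ℕ.⊔ My) (Nx ℕ.⊔ Ny) n≥
        m≥N = ℕ.m⊔n≤o⇒n≤o (Mx ℕ.⊔ My) (Nx ℕ.⊔ Ny) m≥
        n≥N = ℕ.m⊔n≤o⇒n≤o (Mx ℕ.⊔ My) (Nx ℕ.⊔ Ny) n≥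
    in subst (ℚ.∣ seq x m ℚ.* seq y m ℚ.- seq x n ℚ.* seq y n ∣ ℚ.≤_) eq
         (*-close Bx By δ (seq x m) (seq y m) (seq x n) (seq y n) {{δ>0}}
           (bx m (ℕ.m⊔n≤o⇒m≤o Mx My m≥M)) (by n (ℕ.m⊔n≤o⇒n≤o Mx My n≥M))
           (hx m n (ℕ.m⊔n≤o⇒m≤o Nx Ny m≥N) (ℕ.m⊔n≤o⇒m≤o Nx Ny n≥N))
           (hy m n (ℕ.m⊔n≤o⇒n≤o Nx Ny m≥N) (ℕ.m⊔n≤o⇒n≤o Nx Ny n≥N)))

∑ℝ : ∀ {n} → Vector ℝ n → ℝ
∑ℝ = Vector.foldr _+ℝ_ 0ℝ

------------------------------------------------------------------------
-- Finite subsets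

record Finite {A : Set a} (S : Pred A p) : Set (a ⊔ p) where
  field
    elements   : List A
    unique     : Unique elements
    ∈-elements : ∀ {x} → x ∈ elements ⇔ S x

------------------------------------------------------------------------
-- Laurent polynomials over ℤ as formal sums of terms (c , k), standing for
-- c xᵏ. Integer exponents keep the exponents of the generating functions
-- free of truncated subtraction; terms may repeat, so equality compares
-- coefficients.

Laurent : Set
Laurent = List (ℤ × ℤ)

coeff : Laurent → ℤ → ℤ
coeff []            k = 0ℤ
coeff ((c , j) ∷ f) k = (if does (j ℤ.≟ k) then c else 0ℤ) ℤ.+ coeff f k

infix 4 _≈_ _≃_
infixl 7 _·_

_≈_ : Laurent → Laurent → Set
f ≈ g = ∀ k → coeff f k ≡ coeff g k

_·_ : Laurent → Laurent → Laurent
_·_ = cartesianProductWith λ (c , j) (d , k) → c ℤ.* d , j ℤ.+ k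

x^_ : ℤ → ℤ × ℤ
x^ k = 1ℤ , k

∑x^ : {S : Pred A p} → Finite S → (A → ℤ) → Laurent
∑x^ S-finite f = List.map (λ u → x^ f u) (Finite.elements S-finite)

-- 1 + x + ⋯ + x^(k-1)
[_] : ℕ → Laurent
[ k ] = List.map (λ i → x^ (+ i)) (upTo k)

[k]≉0 : ∀ k .{{_ : ℕ.NonZero k}} → ¬ ([ k ] ≈ [])
[k]≉0 (suc k) [k]≈0 =
  1≢0 (trans (sym (cong (λ t → 1ℤ ℤ.+ t) (tail suc (λ _ ()) k))) ([k]≈0 0ℤ))
  where
  1≢0 : 1ℤ ≢ 0ℤ
  1≢0 ()
  tail : ∀ (f : ℕ → ℕ) → (∀ i → f i ≢ 0) → ∀ k →
         coeff (List.map (λ i → x^ (+ i)) (applyUpTo f k)) 0ℤ ≡ 0ℤ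
  tail f f≢0 zero = refl
  tail f f≢0 (suc k) with f 0 in eq
  ... | zero  with () ← f≢0 0 eq
  ... | suc _ = trans (ℤ.+-identityˡ _) (tail (f ∘ suc) (f≢0 ∘ suc) k)

------------------------------------------------------------------------
-- Rational functions: fractions of Laurent polynomials

record RationalFunction : Set where
  constructor _/_⟨_⟩
  field
    num   : Laurent
    den   : Laurent
    den≉0 : ¬ (den ≈ [])
open RationalFunction

_≃_ : RationalFunction → RationalFunction → Set
F ≃ G = num F · den G ≈ num G · den F

fromLaurent : Laurent → RationalFunction
fromLaurent f = f / [ 1 ] ⟨ [k]≉0 1 ⟩

------------------------------------------------------------------------
-- A sequence s₁, s₂, … is a function s : ℕ → ℕ whose value at 0 is never
-- used. The coordinate indexed by i : Fin n is the (1 + toℕ i)-th one.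

PositiveSequence : (ℕ → ℕ) → Set
PositiveSequence s = ∀ {i} → ℕ.NonZero (s (suc i))

generator : (s : ℕ → ℕ) (n : ℕ) → Fin n → Vector ℝ n
generator s n i j = if does (i Fin.≤? j) then fromℤ (+ s (suc (toℕ j))) else 0ℝ

Parallelepiped : (s : ℕ → ℕ) (n : ℕ) → Pred (Vector ℝ n) 0ℓ
Parallelepiped s n w = Σ[ α ∈ Vector ℝ n ]
  ( (∀ i → 0ℝ ≤ℝ α i × α i <ℝ 1ℝ)
  × (∀ j → w j ≃ℝ ∑ℝ (λ i → α i *ℝ generator s n i j)))

-- Π ∩ ℤⁿ
LatticePoint : (s : ℕ → ℕ) (n : ℕ) → Pred (Vec ℤ n) 0ℓ
LatticePoint s n z = Parallelepiped s n (λ j → fromℤ (lookup z j))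

final : ∀ {m} → Vec ℤ (suc m) → ℤ
final {m} z = lookup z (fromℕ m)

-- Q s m and P s m are built from Π in dimension m + 1: Q_{m+1} and P_m.
Q : ∀ s m → Finite (LatticePoint s (suc m)) → Laurent
Q s m Π-finite = ∑x^ Π-finite final

P : ∀ s {{_ : PositiveSequence s}} m → Finite (LatticePoint s (suc m)) → RationalFunction
P s m Π-finite = Q s m Π-finite / [ s (suc m) ] ⟨ [k]≉0 (s (suc m)) ⟩

------------------------------------------------------------------------
-- Inversion sequences

InversionSequence : (s : ℕ → ℕ) (m : ℕ) → Pred (Vec ℤ m) 0ℓ
InversionSequence s m e = ∀ i → 0ℤ ℤ.≤ lookup e i × lookup e i ℤ.< + s (suc (toℕ i))

InversionSequence-finite : ∀ s m → Finite (InversionSequence s m)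
InversionSequence-finite s zero = record
  { elements   = [] ∷ []
  ; unique     = [] ∷ []
  ; ∈-elements = λ { {[]} → mk⇔ (λ _ ()) (λ _ → here refl) }
  }
InversionSequence-finite s (suc m) = record
  { elements   = cartesianProductWith _∷_ heads tails
  ; unique     = Unique.cartesianProductWith⁺ _∷_ Vec.∷-injective
                   (Unique.map⁺ ℤ.+-injective (Unique.upTo⁺ (s 1))) (unique IH)
  ; ∈-elements = mk⇔ sound complete
  }
  where
  open Finite
  open Equivalence using (to; from)
  IH = InversionSequence-finite (s ∘ suc) m
  heads = List.map +_ (upTo (s 1))
  tails = elements IH

  sound : ∀ {e} → e ∈ cartesianProductWith _∷_ heads tails → InversionSequence s (suc m) e
  sound e∈ i with x , e′ , x∈ , e′∈ , refl ← ∈-cartesianProductWith⁻ _∷_ heads tails e∈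
    with k , k∈ , refl ← ∈-map⁻ +_ x∈ | i
  ... | zero  = +≤+ ℕ.z≤n , +<+ (∈-upTo⁻ k∈)
  ... | suc j = to (∈-elements IH) e′∈ j

  complete : ∀ {e} → InversionSequence s (suc m) e → e ∈ cartesianProductWith _∷_ heads tails
  complete {x ∷ e} h with x | h zero
  ... | + k | _ , +<+ k<s =
    ∈-cartesianProductWith⁺ _∷_ (∈-map⁺ +_ (∈-upTo⁺ k<s)) (from (∈-elements IH) (h ∘ suc))

module _ (s : ℕ → ℕ) {{_ : PositiveSequence s}} where

  -- Here the indices are unshifted: toℕ i ∈ {0, …, m-1} is itself the
  -- candidate ascent.
  Ascent : ∀ {m} → Vec ℤ m → Pred (Fin m) 0ℓ
  Ascent e zero    = 0ℤ ℤ.< lookup e zero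
  Ascent e (suc j) = lookup e (inject₁ j) ℚ./ s (suc (toℕ j))
                 ℚ.< lookup e (suc j) ℚ./ s (suc (suc (toℕ j)))

  ascent? : ∀ {m} (e : Vec ℤ m) → Decidable (Ascent e)
  ascent? e zero    = 0ℤ ℤ.<? lookup e zero
  ascent? e (suc j) = lookup e (inject₁ j) ℚ./ s (suc (toℕ j))
                ℚ.<? lookup e (suc j) ℚ./ s (suc (suc (toℕ j)))

  asc : ∀ {m} → Vec ℤ m → ℕ
  asc {m} e = length (filter (ascent? e) (allFin m))

  exponent : ∀ {k} → Vec ℤ (suc k) → ℤ
  exponent {k} e = + s (suc (suc k)) ℤ.* + asc e
             ℤ.- floor ((+ s (suc (suc k)) ℤ.* final e) ℚ./ s (suc k))

{-# OPTIONS --safe #-}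
module Submission where

-- The coefficients of z with respect to the generators are αⱼ = zⱼ/sⱼ - zⱼ₋₁/sⱼ₋₁ (with z₀/s₀ = 0), so z
-- is a lattice point of Π iff every one of these rationals lies in [0, 1). Write zⱼ = sⱼ aⱼ - eⱼ with
-- 0 ≤ eⱼ < sⱼ for j < n; the condition at j says that aⱼ - aⱼ₋₁ = ⌈eⱼ/sⱼ - eⱼ₋₁/sⱼ₋₁⌉, which is 1 if
-- j - 1 is an ascent of e and 0 otherwise. Hence aₙ₋₁ = asc e, and the condition at n says that zₙ is one
-- of the sₙ consecutive integers starting at ⌈sₙ zₙ₋₁/sₙ₋₁⌉ = sₙ asc e - ⌊sₙ eₙ₋₁/sₙ₋₁⌋. This
-- parametrises Π ∩ ℤⁿ by Iₙ₋₁ × {0, …, sₙ - 1} and factors 1 + x + ⋯ + x^(sₙ-1) out of Qₙ.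

open import Algebra.Bundles using (module AbelianGroup)
import Algebra.Properties.Group as GroupProperties
open import Data.Bool.Base using (true; false; if_then_else_)
open import Data.Bool.Properties using (if-float)
open import Data.Fin.Base using (Fin; zero; suc; toℕ; inject₁)
import Data.Fin.Properties as Fin
open import Data.Integer.Base as ℤ using (ℤ; +_; 0ℤ; 1ℤ; +≤+; +<+)
import Data.Integer.DivMod as ℤ
import Data.Integer.Properties as ℤ
import Data.Integer.Solver as ℤ
import Data.Integer.Tactic.RingSolver as ℤ
open import Data.List.Base as List using ([]; _∷_; _++_; length; filter; tabulate; upTo; cartesianProductWith)
open import Data.List.Membership.Propositional using (_∈_)
open import Data.List.Membership.Propositional.Properties
  using (∈-map⁻; ∈-upTo⁺; ∈-upTo⁻; ∈-cartesianProductWith⁺; ∈-cartesianProductWith⁻)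
open import Data.List.Membership.Propositional.Properties.WithK using (unique∧set⇒bag)
import Data.List.Properties as List
open import Data.List.Relation.Binary.BagAndSetEquality using (∼bag⇒↭)
open import Data.List.Relation.Binary.Permutation.Propositional as ↭ using (_↭_)
open import Data.List.Relation.Binary.Permutation.Propositional.Properties using (map⁺)
open import Data.List.Relation.Unary.All as All using ()
import Data.List.Relation.Unary.All.Properties as All
open import Data.List.Relation.Unary.AllPairs using ([]; _∷_)
open import Data.List.Relation.Unary.Any using (here; there)
open import Data.List.Relation.Unary.Unique.Propositional using (Unique)
import Data.List.Relation.Unary.Unique.Propositional.Properties as Unique
open import Data.Nat.Base as ℕ using (ℕ; zero; suc)
import Data.Nat.DivMod as ℕ
import Data.Nat.Properties as ℕ
open import Data.Product.Base using (∃-syntax; _×_; _,_; proj₁; proj₂)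
open import Data.Rational.Base as ℚ using (ℚ; 0ℚ; 1ℚ; ½; Positive; NonNegative; floor)
import Data.Rational.Literals as ℚ
import Data.Rational.Properties as ℚ
open import Data.Rational.Solver using (module +-*-Solver)
import Data.Rational.Unnormalised.Base as ℚᵘ
import Data.Rational.Unnormalised.Properties as ℚᵘ
open import Data.Sum.Base using (inj₁; inj₂)
open import Data.Unit.Base using (⊤; tt)
open import Data.Vec.Base using (Vec; []; _∷_; lookup)
import Data.Vec.Functional as Vector
open Vector using (Vector)
import Data.Vec.Properties as Vec
open import Function.Base using (_∘_)
open import Function.Bundles using (_⇔_; mk⇔; module Equivalence)
import Function.Properties.Equivalence as ⇔
open import Level using (Level)
open import Relation.Binary.PropositionalEquality
  using (_≡_; refl; sym; trans; cong; cong₂; subst; subst₂; module ≡-Reasoning)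
open import Relation.Nullary.Decidable using (Dec; does; yes; no; does-⇔)
open import Relation.Unary using (Pred; Decidable)
open import Defs

open Equivalence using (to; from)
open Finite
open GroupProperties (AbelianGroup.group ℤ.+-0-abelianGroup) using () renaming (∙-cancelˡ to +-cancelˡ)
open ℝ

private variable
  a p : Level
  A A′ B B′ D D′ : Set a

-- Comparison of rationals and the embedding of the integers.

module _ {p q r s} (s-r≡q-p : s ℚ.- r ≡ q ℚ.- p) where
  private
    open +-*-Solver

    r+[p-r]≡p : r ℚ.+ (p ℚ.- r) ≡ p
    r+[p-r]≡p = solve 2 (λ p r → r :+ (p :- r) := p) refl p r

    s+[p-r]≡q : s ℚ.+ (p ℚ.- r) ≡ q
    s+[p-r]≡q =
      trans (solve 3 (λ p r s → s :+ (p :- r) := (s :- r) :+ p) refl p r s)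
      (trans (cong (ℚ._+ p) s-r≡q-p)
      (solve 2 (λ p q → (q :- p) :+ p := q) refl p q))

  -- Adding `p - r` to both sides of the known inequality gives the goal. Linear inequalities below
  -- are thereby reduced to a sum of known ones and a ring identity for the solver.
  ≤-byDifference : r ℚ.≤ s → p ℚ.≤ q
  ≤-byDifference r≤s = subst₂ ℚ._≤_ r+[p-r]≡p s+[p-r]≡q (ℚ.+-monoˡ-≤ (p ℚ.- r) r≤s)

  <-byDifference : r ℚ.< s → p ℚ.< q
  <-byDifference r<s = subst₂ ℚ._<_ r+[p-r]≡p s+[p-r]≡q (ℚ.+-monoˡ-< (p ℚ.- r) r<s)

fromℤ-+ : ∀ i j → ℚ.fromℤ (i ℤ.+ j) ≡ ℚ.fromℤ i ℚ.+ ℚ.fromℤ j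
fromℤ-+ i j = ℚ.toℚᵘ-injective (ℚᵘ.≃-trans
  (ℚᵘ.*≡* (solve 2 (λ i j → (i :+ j) :* (con 1ℤ :* con 1ℤ) := (i :* con 1ℤ :+ j :* con 1ℤ) :* con 1ℤ) refl i j))
  (ℚᵘ.≃-sym (ℚ.toℚᵘ-homo-+ (ℚ.fromℤ i) (ℚ.fromℤ j))))
  where open ℤ.+-*-Solver

fromℤ-* : ∀ i j → ℚ.fromℤ (i ℤ.* j) ≡ ℚ.fromℤ i ℚ.* ℚ.fromℤ j
fromℤ-* i j = ℚ.toℚᵘ-injective (ℚᵘ.≃-trans
  (ℚᵘ.*≡* (solve 2 (λ i j → (i :* j) :* (con 1ℤ :* con 1ℤ) := (i :* j) :* con 1ℤ) refl i j))
  (ℚᵘ.≃-sym (ℚ.toℚᵘ-homo-* (ℚ.fromℤ i) (ℚ.fromℤ j))))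
  where open ℤ.+-*-Solver

fromℤ-neg : ∀ i → ℚ.fromℤ (ℤ.- i) ≡ ℚ.- ℚ.fromℤ i
fromℤ-neg i = ℚ.toℚᵘ-injective (ℚᵘ.≃-sym (ℚ.toℚᵘ-homo‿- (ℚ.fromℤ i)))

fromℤ-- : ∀ i j → ℚ.fromℤ (i ℤ.- j) ≡ ℚ.fromℤ i ℚ.- ℚ.fromℤ j
fromℤ-- i j = trans (fromℤ-+ i (ℤ.- j)) (cong (ℚ.fromℤ i ℚ.+_) (fromℤ-neg j))

fromℤ-mono-≤ : ∀ {i j} → i ℤ.≤ j → ℚ.fromℤ i ℚ.≤ ℚ.fromℤ j
fromℤ-mono-≤ i≤j = ℚ.*≤* (ℤ.*-monoʳ-≤-nonNeg 1ℤ i≤j)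

fromℤ-mono-< : ∀ {i j} → i ℤ.< j → ℚ.fromℤ i ℚ.< ℚ.fromℤ j
fromℤ-mono-< i<j = ℚ.*<* (ℤ.*-monoʳ-<-pos 1ℤ i<j)

fromℤ-cancel-< : ∀ {i j} → ℚ.fromℤ i ℚ.< ℚ.fromℤ j → i ℤ.< j
fromℤ-cancel-< (ℚ.*<* i<j) = ℤ.*-cancelʳ-<-nonNeg 1ℤ i<j

/-*-cancel : ∀ i n .{{_ : ℕ.NonZero n}} → (i ℚ./ n) ℚ.* ℚ.fromℤ (+ n) ≡ ℚ.fromℤ i
/-*-cancel i n@(suc n-1) = ℚ.toℚᵘ-injective (ℚᵘ.≃-trans (ℚ.toℚᵘ-homo-* (i ℚ./ n) (ℚ.fromℤ (+ n)))
  (ℚᵘ.≃-trans (ℚᵘ.*-congʳ {ℚ.toℚᵘ (ℚ.fromℤ (+ n))} (ℚ.toℚᵘ-fromℚᵘ (ℚᵘ.mkℚᵘ i n-1)))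
  (ℚᵘ.*≡* (solve 2 (λ i n → (i :* n) :* con 1ℤ := i :* (n :* con 1ℤ)) refl i (+ n)))))
  where open ℤ.+-*-Solver

fromℤ-pos : ∀ n .{{_ : ℕ.NonZero n}} → Positive (ℚ.fromℤ (+ n))
fromℤ-pos (suc n) = _

floor≤ : ∀ p → ℚ.fromℤ (floor p) ℚ.≤ p
floor≤ p@record{} = ℚ.*≤* (subst (floor p ℤ.* ℚ.↧ p ℤ.≤_) (sym (ℤ.*-identityʳ (ℚ.↥ p)))
  (ℤ.[n/d]*d≤n (ℚ.↥ p) (ℚ.↧ p)))

<floor+1 : ∀ p → p ℚ.< ℚ.fromℤ (floor p) ℚ.+ 1ℚ
<floor+1 p@record{} = subst (p ℚ.<_) (trans (cong ℚ.fromℤ (ℤ.+-comm 1ℤ (floor p))) (fromℤ-+ (floor p) 1ℤ))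
  (ℚ.*<* (subst₂ ℤ._<_ (sym (ℤ.*-identityʳ (ℚ.↥ p)))
    (cong (λ t → ℤ.suc t ℤ.* ℚ.↧ p) (sym (ℤ.div-pos-is-/ℕ (ℚ.↥ p) (ℚ.↧ₙ p))))
    (ℤ.n<s[n/ℕd]*d (ℚ.↥ p) (ℚ.↧ₙ p))))

-- Ceilings of differences and half-open unit intervals.

-- For u and v in [0, 1) this is ⌈v - u⌉.
jump : ℚ → ℚ → ℕ
jump u v = if does (u ℚ.<? v) then 1 else 0

UnitAbove : ℚ → ℚ → Set
UnitAbove p q = p ℚ.≤ q × q ℚ.< p ℚ.+ 1ℚ

InUnit : ℚ → Set
InUnit u = 0ℚ ℚ.≤ u × u ℚ.< 1ℚ

open +-*-Solver

-- Rearranged, the bounds are v - u ≤ `jump u v` < v - u + 1. As v - u lies in (-1, 1), the value 1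
-- can violate only the second, namely when v ≤ u, and the value 0 only the first, namely when u <
-- v.
UnitAbove-jump : ∀ {u v} → InUnit u → InUnit v →
            UnitAbove (ℚ.- u) (ℚ.fromℤ (+ jump u v) ℚ.- v)
UnitAbove-jump {u} {v} (0≤u , u<1) (0≤v , v<1) = go (u ℚ.<? v)
  where
  go : (u<?v : Dec (u ℚ.< v)) → UnitAbove (ℚ.- u) (ℚ.fromℤ (+ (if does u<?v then 1 else 0)) ℚ.- v)
  go (yes u<v) =
    ≤-byDifference (solve 2 (λ u v → (u :+ con 1ℚ) :- (con 0ℚ :+ v) := (con 1ℚ :- v) :- (:- u)) refl u v)
      (ℚ.+-mono-≤ 0≤u (ℚ.<⇒≤ v<1)) ,
    <-byDifference (solve 2 (λ u v → v :- u := (:- u :+ con 1ℚ) :- (con 1ℚ :- v)) refl u v) u<v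
  go (no u≮v) =
    ≤-byDifference (solve 2 (λ u v → u :- v := (con 0ℚ :- v) :- (:- u)) refl u v) (ℚ.≮⇒≥ u≮v) ,
    <-byDifference (solve 2 (λ u v → (con 1ℚ :+ v) :- (u :+ con 0ℚ) := (:- u :+ con 1ℚ) :- (con 0ℚ :- v)) refl u v)
      (ℚ.+-mono-<-≤ u<1 0≤v)

UnitAbove-+ : ∀ {p q} r → UnitAbove p q → UnitAbove (r ℚ.+ p) (r ℚ.+ q)
UnitAbove-+ {p} {q} r (p≤q , q<p+1) = ℚ.+-monoʳ-≤ r p≤q ,
  subst (r ℚ.+ q ℚ.<_) (sym (ℚ.+-assoc r p 1ℚ)) (ℚ.+-monoʳ-< r q<p+1)

-- A translate of `UnitAbove-jump`. With zⱼ₋₁/sⱼ₋₁ = a - u and zⱼ/sⱼ = aⱼ - v, it is the recursion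
-- step aⱼ = a + `jump u v`.
UnitAbove-ascent : ∀ {u v} → InUnit u → InUnit v → ∀ a →
              UnitAbove (ℚ.fromℤ (+ a) ℚ.- u) (ℚ.fromℤ (+ (a ℕ.+ jump u v)) ℚ.- v)
UnitAbove-ascent {u} {v} hu hv a = subst (UnitAbove (ℚ.fromℤ (+ a) ℚ.- u))
  (trans (sym (ℚ.+-assoc (ℚ.fromℤ (+ a)) (ℚ.fromℤ (+ jump u v)) (ℚ.- v)))
         (cong (ℚ._- v) (sym (fromℤ-+ (+ a) (+ jump u v)))))
  (UnitAbove-+ (ℚ.fromℤ (+ a)) (UnitAbove-jump hu hv))

fromℤ-cancel-<+1 : ∀ {i j} → ℚ.fromℤ i ℚ.< ℚ.fromℤ j ℚ.+ 1ℚ → i ℤ.≤ j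
fromℤ-cancel-<+1 {i} {j} i<j+1 = subst (i ℤ.≤_) (ℤ.pred-suc j) (ℤ.i<j⇒i≤pred[j]
  (fromℤ-cancel-< (subst (ℚ.fromℤ i ℚ.<_) (trans (sym (fromℤ-+ j 1ℤ)) (cong ℚ.fromℤ (ℤ.+-comm j 1ℤ))) i<j+1)))

-- Two points of a half-open interval of length 1 differ by less than 1, and here their difference
-- is the integer i - j.
UnitAbove-unique : ∀ {p v i j} → UnitAbove p (ℚ.fromℤ i ℚ.- v) → UnitAbove p (ℚ.fromℤ j ℚ.- v) → i ≡ j
UnitAbove-unique {p} {v} next-i next-j = ℤ.≤-antisym (bound next-i next-j) (bound next-j next-i)
  where
  bound : ∀ {i j} → UnitAbove p (ℚ.fromℤ i ℚ.- v) → UnitAbove p (ℚ.fromℤ j ℚ.- v) → i ℤ.≤ j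
  bound {i} {j} (_ , i-v<p+1) (p≤j-v , _) = fromℤ-cancel-<+1 (<-byDifference
    (solve 4 (λ i j p v → ((p :+ con 1ℚ) :+ (j :- v)) :- ((i :- v) :+ p) := (j :+ con 1ℚ) :- i) refl
      (ℚ.fromℤ i) (ℚ.fromℤ j) p v)
    (ℚ.+-mono-<-≤ i-v<p+1 p≤j-v))

-- Division by one entry of the sequence.

module _ (s : ℕ) {{_ : ℕ.NonZero s}} where
  private
    S = ℚ.fromℤ (+ s)
    instance
      S>0 : Positive S
      S>0 = fromℤ-pos s
      S≥0 : NonNegative S
      S≥0 = ℚ.pos⇒nonNeg S

  /-unique : ∀ {p i} → p ℚ.* S ≡ ℚ.fromℤ i → p ≡ i ℚ./ s
  /-unique {p} {i} pS≡i = ℚ.≤-antisym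
    (ℚ.*-cancelʳ-≤-pos S (ℚ.≤-reflexive eq)) (ℚ.*-cancelʳ-≤-pos S (ℚ.≤-reflexive (sym eq)))
    where
    eq : p ℚ.* S ≡ (i ℚ./ s) ℚ.* S
    eq = trans pS≡i (sym (/-*-cancel i s))

  /-split : ∀ b x → (+ s ℤ.* b ℤ.- x) ℚ./ s ≡ ℚ.fromℤ b ℚ.- x ℚ./ s
  /-split b x = sym (/-unique (begin
    (ℚ.fromℤ b ℚ.- x ℚ./ s) ℚ.* S         ≡⟨ solve 3 (λ S b v → (b :- v) :* S := S :* b :- v :* S) refl
                                               S (ℚ.fromℤ b) (x ℚ./ s) ⟩
    S ℚ.* ℚ.fromℤ b ℚ.- (x ℚ./ s) ℚ.* S   ≡⟨ cong₂ ℚ._-_ (sym (fromℤ-* (+ s) b)) (/-*-cancel x s) ⟩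
    ℚ.fromℤ (+ s ℤ.* b) ℚ.- ℚ.fromℤ x     ≡⟨ fromℤ-- (+ s ℤ.* b) x ⟨
    ℚ.fromℤ (+ s ℤ.* b ℤ.- x)             ∎))
    where open ≡-Reasoning

  *-/ : ∀ i x → ℚ.fromℤ i ℚ.* (x ℚ./ s) ≡ (i ℤ.* x) ℚ./ s
  *-/ i x = /-unique (begin
    ℚ.fromℤ i ℚ.* (x ℚ./ s) ℚ.* S   ≡⟨ ℚ.*-assoc (ℚ.fromℤ i) (x ℚ./ s) S ⟩
    ℚ.fromℤ i ℚ.* (x ℚ./ s ℚ.* S)   ≡⟨ cong (ℚ.fromℤ i ℚ.*_) (/-*-cancel x s) ⟩
    ℚ.fromℤ i ℚ.* ℚ.fromℤ x         ≡⟨ fromℤ-* i x ⟨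
    ℚ.fromℤ (i ℤ.* x)               ∎)
    where open ≡-Reasoning

  -- Lets the ascent at 0, tested by e₁ > 0, be treated as a comparison with a preceding quotient 0.
  0<⇔0</ : ∀ x → 0ℤ ℤ.< x ⇔ 0ℚ ℚ.< x ℚ./ s
  0<⇔0</ x = mk⇔
    (λ 0<x → ℚ.*-cancelʳ-<-nonNeg S
      (subst₂ ℚ._<_ (sym (ℚ.*-zeroˡ S)) (sym (/-*-cancel x s)) (fromℤ-mono-< 0<x)))
    (λ 0<x/s → fromℤ-cancel-<
      (subst₂ ℚ._<_ (ℚ.*-zeroˡ S) (/-*-cancel x s) (ℚ.*-monoˡ-<-pos S 0<x/s)))

  /-InUnit : ∀ {x} → 0ℤ ℤ.≤ x → x ℤ.< + s → InUnit (x ℚ./ s)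
  /-InUnit {x} 0≤x x<s =
    ℚ.*-cancelʳ-≤-pos S (subst₂ ℚ._≤_ (sym (ℚ.*-zeroˡ S)) (sym (/-*-cancel x s)) (fromℤ-mono-≤ 0≤x)) ,
    ℚ.*-cancelʳ-<-nonNeg S (subst₂ ℚ._<_ (sym (/-*-cancel x s)) (sym (ℚ.*-identityˡ S)) (fromℤ-mono-< x<s))

  -- Division with remainder is applied to `- y`, so that the remainder enters y with a minus sign.
  decompose : ∀ y → ∃[ b ] ∃[ x ] (0ℤ ℤ.≤ x × x ℤ.< + s × y ≡ + s ℤ.* b ℤ.- x)
  decompose y = ℤ.- q , + r , +≤+ ℕ.z≤n , +<+ (ℤ.n%ℕd<d (ℤ.- y) s) , (begin
    y                                ≡⟨ ℤ.neg-involutive y ⟨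
    ℤ.- (ℤ.- y)                      ≡⟨ cong ℤ.-_ (ℤ.a≡a%ℕn+[a/ℕn]*n (ℤ.- y) s) ⟩
    ℤ.- (+ r ℤ.+ q ℤ.* + s)          ≡⟨ regroup (+ r) q (+ s) ⟩
    + s ℤ.* (ℤ.- q) ℤ.- + r          ∎)
    where
    open ≡-Reasoning
    regroup : ∀ r q s → ℤ.- (r ℤ.+ q ℤ.* s) ≡ s ℤ.* (ℤ.- q) ℤ.- r
    regroup = ℤ.solve-∀
    q = (ℤ.- y) ℤ./ℕ s
    r = (ℤ.- y) ℤ.%ℕ s

  -- The least integer y such that y/s ≥ a - u.
  least : ℚ → ℤ → ℤ
  least u a = + s ℤ.* a ℤ.- floor (S ℚ.* u)

  module _ (u : ℚ) (a y : ℤ) where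
    private
      F = ℚ.fromℤ (floor (S ℚ.* u))
      q = ℚ.fromℤ a ℚ.- u
      v = y ℚ./ s
      w = y ℤ.- least u a

      scaled : ℚ.fromℤ w ≡ v ℚ.* S ℚ.- (S ℚ.* ℚ.fromℤ a ℚ.- F)
      scaled = begin
        ℚ.fromℤ w                                  ≡⟨ fromℤ-- y (least u a) ⟩
        ℚ.fromℤ y ℚ.- ℚ.fromℤ (least u a)          ≡⟨ cong₂ ℚ._-_ (sym (/-*-cancel y s))
          (trans (fromℤ-- (+ s ℤ.* a) (floor (S ℚ.* u))) (cong (ℚ._- F) (fromℤ-* (+ s) a))) ⟩
        v ℚ.* S ℚ.- (S ℚ.* ℚ.fromℤ a ℚ.- F)        ∎
        where open ≡-Reasoning

    -- After multiplication by `S` the interval starts at S a - S u, and F ≤ S u < F + 1 compares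
    -- this with S a - F, which is `least u a`. The lower end gives w > -1, which suffices for an
    -- integer.
    UnitAbove⇒least : UnitAbove q v → 0ℤ ℤ.≤ w × w ℤ.< + s
    UnitAbove⇒least (q≤v , v<q+1) =
      fromℤ-cancel-<+1 (subst (λ W → 0ℚ ℚ.< W ℚ.+ 1ℚ) (sym scaled) (<-byDifference
        (solve 5 (λ v S a u F → (v :* S :+ (F :+ con 1ℚ)) :- ((a :- u) :* S :+ S :* u)
                    := (v :* S :- (S :* a :- F) :+ con 1ℚ) :- con 0ℚ) refl v S (ℚ.fromℤ a) u F)
        (ℚ.+-mono-≤-< (ℚ.*-monoʳ-≤-nonNeg S q≤v) (<floor+1 (S ℚ.* u))))) ,
      fromℤ-cancel-< (subst (ℚ._< S) (sym scaled) (<-byDifference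
        (solve 5 (λ v S a u F → ((a :- u :+ con 1ℚ) :* S :+ S :* u) :- (v :* S :+ F)
                    := S :- (v :* S :- (S :* a :- F))) refl v S (ℚ.fromℤ a) u F)
        (ℚ.+-mono-<-≤ (ℚ.*-monoˡ-<-pos S v<q+1) (floor≤ (S ℚ.* u)))))

    least⇒UnitAbove : 0ℤ ℤ.≤ w → w ℤ.< + s → UnitAbove q v
    least⇒UnitAbove 0≤w w<s =
      ℚ.*-cancelʳ-≤-pos S (≤-byDifference
        (solve 5 (λ v S a u F → ((v :* S :- (S :* a :- F)) :+ S :* u) :- (con 0ℚ :+ F)
                    := v :* S :- (a :- u) :* S) refl v S (ℚ.fromℤ a) u F)
        (ℚ.+-mono-≤ (subst (0ℚ ℚ.≤_) scaled (fromℤ-mono-≤ 0≤w)) (floor≤ (S ℚ.* u)))) ,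
      ℚ.*-cancelʳ-<-nonNeg S (<-byDifference
        (solve 5 (λ v S a u F → (S :+ (F :+ con 1ℚ)) :- ((con 1ℚ :+ (v :* S :- (S :* a :- F))) :+ S :* u)
                    := (a :- u :+ con 1ℚ) :* S :- v :* S) refl v S (ℚ.fromℤ a) u F)
        (ℚ.+-mono-≤-<
          -- The integer bound w < s is sharpened to 1 + w ≤ s, because the floor only yields S u <
          -- F + 1.
          (subst (λ W → 1ℚ ℚ.+ W ℚ.≤ S) scaled (subst (ℚ._≤ S) (fromℤ-+ 1ℤ w) (fromℤ-mono-≤ (ℤ.i<j⇒suc[i]≤j w<s))))
          (<floor+1 (S ℚ.* u))))

-- Admissible vectors, null sequences and limits.

-- Every αⱼ = zⱼ/sⱼ - zⱼ₋₁/sⱼ₋₁ lies in [0, 1), where q stands for the quotient preceding the first coordinate.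
Admissible : ∀ s {{_ : PositiveSequence s}} {m} → ℚ → Vec ℤ m → Set
Admissible s q []      = ⊤
Admissible s q (y ∷ z) = UnitAbove q (y ℚ./ s 1) × Admissible (s ∘ suc) (y ℚ./ s 1) z

-- `x ≃ℝ y` unfolds to `Null` of the termwise difference, so real equations can be manipulated as
-- null sequences of rationals.
Null : (ℕ → ℚ) → Set
Null f = ∀ ε → .{{Positive ε}} → ∃[ N ] (∀ n → N ℕ.≤ n → ℚ.∣ f n ∣ ℚ.≤ ε)

Null-resp : ∀ {f g} → (∀ n → f n ≡ g n) → Null f → Null g
Null-resp f≡g f→0 ε = let N , h = f→0 ε in N , λ n N≤n → subst (λ x → ℚ.∣ x ∣ ℚ.≤ ε) (f≡g n) (h n N≤n)

Null-≡0 : ∀ {f} → (∀ n → f n ≡ 0ℚ) → Null f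
Null-≡0 f≡0 ε = 0 , λ n _ → subst (λ x → ℚ.∣ x ∣ ℚ.≤ ε) (sym (f≡0 n)) (ℚ.<⇒≤ (ℚ.positive⁻¹ ε))

Null-+ : ∀ {f g} → Null f → Null g → Null (λ n → f n ℚ.+ g n)
Null-+ {f} {g} f→0 g→0 ε = M ℕ.⊔ N , λ n n≥ → begin
    ℚ.∣ f n ℚ.+ g n ∣          ≤⟨ ℚ.∣p+q∣≤∣p∣+∣q∣ (f n) (g n) ⟩
    ℚ.∣ f n ∣ ℚ.+ ℚ.∣ g n ∣    ≤⟨ ℚ.+-mono-≤ (hf n (ℕ.m⊔n≤o⇒m≤o M N n≥)) (hg n (ℕ.m⊔n≤o⇒n≤o M N n≥)) ⟩
    ½ ℚ.* ε ℚ.+ ½ ℚ.* ε        ≡⟨ ℚ.*-distribʳ-+ ε ½ ½ ⟨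
    1ℚ ℚ.* ε                   ≡⟨ ℚ.*-identityˡ ε ⟩
    ε                          ∎
  where
  open ℚ.≤-Reasoning
  instance
    ½ε>0 : Positive (½ ℚ.* ε)
    ½ε>0 = ℚ.pos*pos⇒pos ½ ε
  M = proj₁ (f→0 (½ ℚ.* ε))
  hf = proj₂ (f→0 (½ ℚ.* ε))
  N = proj₁ (g→0 (½ ℚ.* ε))
  hg = proj₂ (g→0 (½ ℚ.* ε))

Null-* : ∀ {f} c → Null f → Null (λ n → c ℚ.* f n)
Null-* {f} c f→0 ε =
  let δ , δ>0 , Cδ≡ε = split-tolerance C ε
      N , h = f→0 δ {{δ>0}}
  in N , λ n N≤n → begin
    ℚ.∣ c ℚ.* f n ∣            ≡⟨ ℚ.∣p*q∣≡∣p∣*∣q∣ c (f n) ⟩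
    ℚ.∣ c ∣ ℚ.* ℚ.∣ f n ∣      ≤⟨ ℚ.*-monoʳ-≤-nonNeg ℚ.∣ f n ∣ {{ℚ.∣-∣-nonNeg (f n)}} c≤C ⟩
    C ℚ.* ℚ.∣ f n ∣            ≤⟨ ℚ.*-monoˡ-≤-nonNeg C {{ℚ.pos⇒nonNeg C}} (h n N≤n) ⟩
    C ℚ.* δ                    ≡⟨ Cδ≡ε ⟩
    ε                          ∎
  where
  open ℚ.≤-Reasoning
  -- The summand 1 keeps the bound positive when c = 0, so that ε can be divided by it.
  C = 1ℚ ℚ.+ ℚ.∣ c ∣
  instance
    C>0 : Positive C
    C>0 = ℚ.pos+nonNeg⇒pos 1ℚ ℚ.∣ c ∣ {{ℚ.∣-∣-nonNeg c}}
  c≤C : ℚ.∣ c ∣ ℚ.≤ C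
  c≤C = subst (ℚ._≤ C) (ℚ.+-identityˡ ℚ.∣ c ∣) (ℚ.+-monoˡ-≤ ℚ.∣ c ∣ (ℚ.<⇒≤ (ℚ.positive⁻¹ 1ℚ)))

p≤∣p∣ : ∀ p → p ℚ.≤ ℚ.∣ p ∣
p≤∣p∣ p with ℚ.∣p∣≡p∨∣p∣≡-p p
... | inj₁ ∣p∣≡p  = ℚ.≤-reflexive (sym ∣p∣≡p)
... | inj₂ ∣p∣≡-p = ℚ.≤-trans (≤-byDifference (solve 1 (λ p → :- p :- con 0ℚ := con 0ℚ :- p) refl p)
                                 (subst (0ℚ ℚ.≤_) ∣p∣≡-p (ℚ.0≤∣p∣ p)))
                               (ℚ.0≤∣p∣ p)

-- If q < p, taking half the gap as ε gives p ≤ (p + q)/2, which is impossible.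
≤-approximate : ∀ {p q} → (∀ ε → .{{Positive ε}} → p ℚ.≤ q ℚ.+ ε) → p ℚ.≤ q
≤-approximate {p} {q} h = ℚ.≮⇒≥ λ q<p →
  let instance
        d>0 : Positive (½ ℚ.* (p ℚ.- q))
        d>0 = ℚ.pos*pos⇒pos ½ (p ℚ.- q) {{ℚ.positive {p ℚ.- q} (<-byDifference
                (solve 2 (λ p q → p :- q := (p :- q) :- con 0ℚ) refl p q) q<p)}}
  in ℚ.<-irrefl refl (ℚ.<-≤-trans (ℚ.positive⁻¹ (½ ℚ.* (p ℚ.- q))) (≤-byDifference
        (solve 2 (λ p q → (q :+ con ½ :* (p :- q)) :- p := con 0ℚ :- con ½ :* (p :- q)) refl p q)
        (h (½ ℚ.* (p ℚ.- q)))))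

-- For large n, both 0 ≤ xₙ + ε/2 and xₙ - p ≤ ε/2 hold, and they add up to 0 ≤ p + ε.
0≤-limit : ∀ x {p} → 0ℝ ≤ℝ x → Null (λ n → p ℚ.- seq x n) → 0ℚ ℚ.≤ p
0≤-limit x {p} 0≤x p-x→0 = ≤-approximate λ ε →
  let instance
        ½ε>0 : Positive (½ ℚ.* ε)
        ½ε>0 = ℚ.pos*pos⇒pos ½ ε
      M , hM = 0≤x (½ ℚ.* ε)
      N , hN = p-x→0 (½ ℚ.* ε)
      n = M ℕ.⊔ N
      x-p≤ = ℚ.≤-trans (p≤∣p∣ (seq x n ℚ.- p))
               (subst (ℚ._≤ ½ ℚ.* ε) (∣-∣-comm p (seq x n)) (hN n (ℕ.m≤n⊔m M N)))
  in ≤-byDifference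
       (solve 3 (λ p x ε → ((x :+ con ½ :* ε) :+ con ½ :* ε) :- (con 0ℚ :+ (x :- p)) := (p :+ ε) :- con 0ℚ) refl
         p (seq x n) ε)
       (ℚ.+-mono-≤ (hM n (ℕ.m≤m⊔n M N)) x-p≤)
  where
  ∣-∣-comm : ∀ p q → ℚ.∣ p ℚ.- q ∣ ≡ ℚ.∣ q ℚ.- p ∣
  ∣-∣-comm p q = trans (sym (ℚ.∣-p∣≡∣p∣ (p ℚ.- q))) (cong ℚ.∣_∣ (solve 2 (λ p q → :- (p :- q) := q :- p) refl p q))

-- Strictness survives the limit because `<ℝ` supplies a uniform gap δ: half of it absorbs the error
-- p - xₙ, the other half remains.
<1-limit : ∀ x {p} → x <ℝ 1ℝ → Null (λ n → p ℚ.- seq x n) → p ℚ.< 1ℚ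
<1-limit x {p} (δ , δ>0 , M , hM) p-x→0 =
  let instance
        ½δ>0 : Positive (½ ℚ.* δ)
        ½δ>0 = ℚ.pos*pos⇒pos ½ δ {{δ>0}}
      N , hN = p-x→0 (½ ℚ.* δ)
      n = M ℕ.⊔ N
  in <-byDifference
       (solve 3 (λ p x δ → (con 1ℚ :+ (con ½ :* δ) :+ con ½ :* δ) :- ((x :+ δ) :+ (p :- x) :+ con 0ℚ)
                   := con 1ℚ :- p) refl p (seq x n) δ)
       (ℚ.+-mono-≤-< (ℚ.+-mono-≤ (hM n (ℕ.m≤m⊔n M N))
                                 (ℚ.≤-trans (p≤∣p∣ (p ℚ.- seq x n)) (hN n (ℕ.m≤n⊔m M N))))
                     (ℚ.positive⁻¹ (½ ℚ.* δ)))

0≤-fromℚ : ∀ {p} → 0ℚ ℚ.≤ p → 0ℝ ≤ℝ fromℚ p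
0≤-fromℚ {p} 0≤p ε = 0 , λ _ _ → ℚ.≤-trans 0≤p
  (subst (ℚ._≤ p ℚ.+ ε) (ℚ.+-identityʳ p) (ℚ.+-monoʳ-≤ p (ℚ.<⇒≤ (ℚ.positive⁻¹ ε))))

<1-fromℚ : ∀ {p} → p ℚ.< 1ℚ → fromℚ p <ℝ 1ℝ
<1-fromℚ {p} p<1 =
  1ℚ ℚ.- p ,
  ℚ.positive {1ℚ ℚ.- p} (<-byDifference (solve 1 (λ p → con 1ℚ :- p := (con 1ℚ :- p) :- con 0ℚ) refl p) p<1) ,
  0 , λ _ _ → ℚ.≤-reflexive (solve 1 (λ p → p :+ (con 1ℚ :- p) := con 1ℚ) refl p)

-- Combinations of the generators as a triangular system.

∑ : ∀ {m} → Vector ℚ m → ℚ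
∑ = Vector.foldr ℚ._+_ 0ℚ

∑-cong : ∀ {m} (v w : Vector ℚ m) → (∀ i → v i ≡ w i) → ∑ v ≡ ∑ w
∑-cong {zero}  v w v≡w = refl
∑-cong {suc m} v w v≡w = cong₂ ℚ._+_ (v≡w zero) (∑-cong (v ∘ suc) (w ∘ suc) (v≡w ∘ suc))

∑-zero : ∀ {m} (v : Vector ℚ m) → (∀ i → v i ≡ 0ℚ) → ∑ v ≡ 0ℚ
∑-zero {zero}  v v≡0 = refl
∑-zero {suc m} v v≡0 = trans (cong₂ ℚ._+_ (v≡0 zero) (∑-zero (v ∘ suc) (v≡0 ∘ suc))) (ℚ.+-identityˡ 0ℚ)

seq-∑ℝ : ∀ {m} (v : Vector ℝ m) N → seq (∑ℝ v) N ≡ ∑ (λ i → seq (v i) N)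
seq-∑ℝ {zero}  v N = refl
seq-∑ℝ {suc m} v N = cong (seq (v zero) N ℚ.+_) (seq-∑ℝ (v ∘ suc) N)

combination : ∀ (s : ℕ → ℕ) {m} → Vector ℚ m → Fin m → ℚ
combination s {m} β j = ∑ λ i → β i ℚ.* (if does (i Fin.≤? j) then ℚ.fromℤ (+ s (suc (toℕ j))) else 0ℚ)

combination-zero : ∀ (s : ℕ → ℕ) {m} (β : Vector ℚ (suc m)) →
  combination s β zero ≡ β zero ℚ.* ℚ.fromℤ (+ s 1)
combination-zero s {m} β =
  trans (cong (x ℚ.+_) (∑-zero (λ i → β (suc i) ℚ.* 0ℚ) (λ i → ℚ.*-zeroʳ (β (suc i))))) (ℚ.+-identityʳ x)
  where x = β zero ℚ.* ℚ.fromℤ (+ s 1)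

-- Only the first generator has a nonzero first coordinate. Splitting it off leaves the generators
-- of the shifted sequence, which permits induction on the dimension.
combination-suc : ∀ (s : ℕ → ℕ) {m} (β : Vector ℚ (suc m)) j →
  combination s β (suc j) ≡ β zero ℚ.* ℚ.fromℤ (+ s (suc (suc (toℕ j)))) ℚ.+ combination (s ∘ suc) (β ∘ suc) j
combination-suc s {m} β j = cong (x ℚ.+_) (∑-cong
    (λ i → β (suc i) ℚ.* (if does (suc i Fin.≤? suc j) then T else 0ℚ))
    (λ i → β (suc i) ℚ.* (if does (i Fin.≤? j) then T else 0ℚ)) λ where
    zero    → refl
    (suc i) → refl)
  where
  T = ℚ.fromℤ (+ s (suc (suc (toℕ j))))
  x = β zero ℚ.* T

seq-combination : ∀ (s : ℕ → ℕ) {m} (α : Vector ℝ m) j N →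
  seq (∑ℝ (λ i → α i *ℝ generator s m i j)) N ≡ combination s (λ i → seq (α i) N) j
seq-combination s {m} α j N = trans (seq-∑ℝ (λ i → α i *ℝ generator s m i j) N)
  (∑-cong (λ i → seq (α i) N ℚ.* seq (generator s m i j) N)
    (λ i → seq (α i) N ℚ.* (if does (i Fin.≤? j) then ℚ.fromℤ (+ s (suc (toℕ j))) else 0ℚ))
    λ i → cong (seq (α i) N ℚ.*_) (if-float (λ x → seq x N) (does (i Fin.≤? j))))

-- Membership in Π generalised for induction: `q` is the sum of the coefficients already split off,
-- whose generators contribute `q` times sⱼ to coordinate j. For `q` = 0 this is `LatticePoint`.
record Representable (s : ℕ → ℕ) {m} (q : ℚ) (z : Vec ℤ m) : Set where
  constructor representable
  field
    α         : Vector ℝ m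
    bounds    : ∀ i → 0ℝ ≤ℝ α i × α i <ℝ 1ℝ
    converges : ∀ j → Null λ N →
      ℚ.fromℤ (lookup z j) ℚ.- (q ℚ.* ℚ.fromℤ (+ s (suc (toℕ j))) ℚ.+ combination s (λ i → seq (α i) N) j)

-- The first coordinate forces the real coefficient `α zero` to have the rational limit v - q, so
-- its bounds pass to v - q. The remaining coordinates then satisfy the same system with v in place
-- of q.
Representable⇒Admissible : ∀ s {{_ : PositiveSequence s}} {m q} (z : Vec ℤ m) →
  Representable s q z → Admissible s q z
Representable⇒Admissible s [] _ = tt
Representable⇒Admissible s {q = q} (y ∷ z) (representable α bounds converges) =
  ( ≤-byDifference (solve 2 (λ v q → (v :- q) :- con 0ℚ := v :- q) refl v q)
      (0≤-limit (α zero) {v ℚ.- q} (proj₁ (bounds zero)) head→0)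
  , <-byDifference (solve 2 (λ v q → con 1ℚ :- (v :- q) := (q :+ con 1ℚ) :- v) refl v q)
      (<1-limit (α zero) {v ℚ.- q} (proj₂ (bounds zero)) head→0)) ,
  Representable⇒Admissible (s ∘ suc) z (representable (α ∘ suc) (bounds ∘ suc) λ j →
    -- Adding the null sequence -T (v - q - α₁) to the relation for a later coordinate turns the
    -- offset q into v.
    Null-resp (λ N → trans
        (cong (λ c → (ℚ.fromℤ (lookup z j) ℚ.- (q ℚ.* T j ℚ.+ c)) ℚ.+ ℚ.- T j ℚ.* (v ℚ.- q ℚ.- seq (α zero) N))
              (combination-suc s (λ i → seq (α i) N) j))
        (solve 6 (λ Z q T A c v → (Z :- (q :* T :+ (A :* T :+ c))) :+ :- T :* (v :- q :- A) := Z :- (v :* T :+ c)) refl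
          (ℚ.fromℤ (lookup z j)) q (T j) (seq (α zero) N) (combination (s ∘ suc) (λ i → seq (α (suc i)) N) j) v))
      (Null-+ (converges (suc j)) (Null-* (ℚ.- T j) head→0)))
  where
  v = y ℚ./ s 1
  S = ℚ.fromℤ (+ s 1)
  T : Fin _ → ℚ
  T j = ℚ.fromℤ (+ s (suc (suc (toℕ j))))
  instance
    S>0 : Positive S
    S>0 = fromℤ-pos (s 1)
    S≢0 : ℚ.NonZero S
    S≢0 = ℚ.pos⇒nonZero S
  head→0 : Null (λ N → (v ℚ.- q) ℚ.- seq (α zero) N)
  -- This is the relation for the first coordinate divided by s₁.
  head→0 = Null-resp (λ N → begin
      ℚ.1/ S ℚ.* (ℚ.fromℤ y ℚ.- (q ℚ.* S ℚ.+ combination s (λ i → seq (α i) N) zero))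
        ≡⟨ cong₂ (λ Y c → ℚ.1/ S ℚ.* (Y ℚ.- (q ℚ.* S ℚ.+ c))) (sym (/-*-cancel y (s 1)))
                 (combination-zero s (λ i → seq (α i) N)) ⟩
      ℚ.1/ S ℚ.* (v ℚ.* S ℚ.- (q ℚ.* S ℚ.+ seq (α zero) N ℚ.* S))
        ≡⟨ solve 5 (λ I S v q A → I :* (v :* S :- (q :* S :+ A :* S)) := (I :* S) :* (v :- q :- A)) refl
             (ℚ.1/ S) S v q (seq (α zero) N) ⟩
      (ℚ.1/ S ℚ.* S) ℚ.* (v ℚ.- q ℚ.- seq (α zero) N)
        ≡⟨ cong (ℚ._* (v ℚ.- q ℚ.- seq (α zero) N)) (ℚ.*-inverseˡ S) ⟩
      1ℚ ℚ.* (v ℚ.- q ℚ.- seq (α zero) N)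
        ≡⟨ ℚ.*-identityˡ _ ⟩
      v ℚ.- q ℚ.- seq (α zero) N ∎)
    (Null-* (ℚ.1/ S) (converges zero))
    where open ≡-Reasoning

-- Successive differences of quotients, as constant sequences, serve as coefficients; the system
-- then holds exactly at every index.
Admissible⇒Representable : ∀ s {{_ : PositiveSequence s}} {m q} (z : Vec ℤ m) →
  Admissible s q z → Representable s q z
Admissible⇒Representable s [] _ = representable (λ ()) (λ ()) (λ ())
Admissible⇒Representable s {q = q} (y ∷ z) ((q≤v , v<q+1) , adm)
  with representable α bounds converges ← Admissible⇒Representable (s ∘ suc) z adm
  = representable β βbounds λ
  { zero → Null-≡0 λ N → begin
      ℚ.fromℤ y ℚ.- (q ℚ.* S ℚ.+ combination s (λ i → seq (β i) N) zero)
        ≡⟨ cong₂ (λ Y c → Y ℚ.- (q ℚ.* S ℚ.+ c)) (sym (/-*-cancel y (s 1))) (combination-zero s (λ i → seq (β i) N)) ⟩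
      v ℚ.* S ℚ.- (q ℚ.* S ℚ.+ (v ℚ.- q) ℚ.* S)
        ≡⟨ solve 3 (λ v S q → v :* S :- (q :* S :+ (v :- q) :* S) := con 0ℚ) refl v S q ⟩
      0ℚ ∎
  ; (suc j) → Null-resp (λ N → sym (trans
        (cong (λ c → ℚ.fromℤ (lookup z j) ℚ.- (q ℚ.* T j ℚ.+ c)) (combination-suc s (λ i → seq (β i) N) j))
        (solve 5 (λ Z q T c v → Z :- (q :* T :+ ((v :- q) :* T :+ c)) := Z :- (v :* T :+ c)) refl
          (ℚ.fromℤ (lookup z j)) q (T j) (combination (s ∘ suc) (λ i → seq (α i) N) j) v))) (converges j)
  }
  where
  open ≡-Reasoning
  v = y ℚ./ s 1
  S = ℚ.fromℤ (+ s 1)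
  T : Fin _ → ℚ
  T j = ℚ.fromℤ (+ s (suc (suc (toℕ j))))
  β = fromℚ (v ℚ.- q) Vector.∷ α
  βbounds : ∀ i → 0ℝ ≤ℝ β i × β i <ℝ 1ℝ
  βbounds (suc i) = bounds i
  βbounds zero =
    0≤-fromℚ {v ℚ.- q} (≤-byDifference (solve 2 (λ v q → v :- q := (v :- q) :- con 0ℚ) refl v q) q≤v) ,
    <1-fromℚ {v ℚ.- q} (<-byDifference (solve 2 (λ v q → (q :+ con 1ℚ) :- v := con 1ℚ :- (v :- q)) refl v q) v<q+1)

LatticePoint⇔Admissible : ∀ s {{_ : PositiveSequence s}} {m} (z : Vec ℤ m) → LatticePoint s m z ⇔ Admissible s 0ℚ z
LatticePoint⇔Admissible s {m} z = mk⇔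
  (λ (α , bounds , z≃) → Representable⇒Admissible s z (representable α bounds λ j →
    Null-resp (λ N → cong (λ c → ℚ.fromℤ (lookup z j) ℚ.- c) (combination≡ α j N)) (z≃ j)))
  (λ adm → let representable α bounds z→ = Admissible⇒Representable s z adm in
    α , bounds , λ j →
      Null-resp (λ N → cong (λ c → ℚ.fromℤ (lookup z j) ℚ.- c) (sym (combination≡ α j N))) (z→ j))
  where
  combination≡ : ∀ α j N → seq (∑ℝ (λ i → α i *ℝ generator s m i j)) N ≡
    0ℚ ℚ.* ℚ.fromℤ (+ s (suc (toℕ j))) ℚ.+ combination s (λ i → seq (α i) N) j
  combination≡ α j N = trans (seq-combination s α j N)
    (solve 2 (λ S c → c := con 0ℚ :* S :+ c) refl (ℚ.fromℤ (+ s (suc (toℕ j)))) (combination s (λ i → seq (α i) N) j))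

-- Parametrisation of the admissible vectors.

-- u is the quotient eⱼ/sⱼ preceding the remaining entries, a the number of ascents so far, and r the offset of
-- the last coordinate from its least value.
point : ∀ s {{_ : PositiveSequence s}} {m} → ℚ → ℕ → Vec ℤ m → ℕ → Vec ℤ (suc m)
point s u a []      r = least (s 1) u (+ a) ℤ.+ + r ∷ []
point s u a (x ∷ e) r = + s 1 ℤ.* + b ℤ.- x ∷ point (s ∘ suc) (x ℚ./ s 1) b e r
  where b = a ℕ.+ jump u (x ℚ./ s 1)

-- A preceding coordinate s a - x has quotient a - u with u = x/s, whence the form of the offset.
-- Entries of e are handled by `UnitAbove-ascent`, the last coordinate by `least⇒UnitAbove`.
point-admissible : ∀ s {{_ : PositiveSequence s}} {m u a e r} → InUnit u →
  InversionSequence s m e → r ℕ.< s (suc m) →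
  Admissible s (ℚ.fromℤ (+ a) ℚ.- u) (point s u a e r)
point-admissible s {u = u} {a} {[]} {r} _ _ r<s =
  least⇒UnitAbove (s 1) u (+ a) (least (s 1) u (+ a) ℤ.+ + r)
    (subst (0ℤ ℤ.≤_) (sym w≡r) (+≤+ ℕ.z≤n)) (subst (ℤ._< + s 1) (sym w≡r) (+<+ r<s)) , tt
  where
  cancel : ∀ l r → (l ℤ.+ r) ℤ.- l ≡ r
  cancel = ℤ.solve-∀
  w≡r = cancel (least (s 1) u (+ a)) (+ r)
point-admissible s {u = u} {a} {x ∷ e} {r} hu he r<s =
  let 0≤x , x<s = he zero
      hv = /-InUnit (s 1) 0≤x x<s
      b = a ℕ.+ jump u (x ℚ./ s 1)
      eq = sym (/-split (s 1) (+ b) x)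
  in subst (UnitAbove (ℚ.fromℤ (+ a) ℚ.- u)) eq (UnitAbove-ascent hu hv a) ,
     subst (λ q → Admissible (s ∘ suc) q (point (s ∘ suc) (x ℚ./ s 1) b e r)) eq
       (point-admissible (s ∘ suc) hv (he ∘ suc) r<s)

record Preimage s {{_ : PositiveSequence s}} {m} (u : ℚ) (a : ℕ) (z : Vec ℤ (suc m)) : Set where
  constructor preimage
  field
    {e} : Vec ℤ m
    {r} : ℕ
    e∈I : InversionSequence s m e
    r<s : r ℕ.< s (suc m)
    z≡point : z ≡ point s u a e r

-- Each coordinate before the last is decomposed as s b - x, which supplies the entry x; the last
-- one exceeds its least value by r.
Admissible⇒Preimage : ∀ s {{_ : PositiveSequence s}} {m u a} → InUnit u → (z : Vec ℤ (suc m)) →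
  Admissible s (ℚ.fromℤ (+ a) ℚ.- u) z → Preimage s u a z
Admissible⇒Preimage s {zero} {u} {a} hu (y ∷ []) (next , _) =
  let 0≤w , w<s = UnitAbove⇒least (s 1) u (+ a) y next
      w≡r = ℤ.0≤i⇒+∣i∣≡i 0≤w
  in preimage {e = []} (λ ()) (ℤ.drop‿+<+ (subst (ℤ._< + s 1) (sym w≡r) w<s))
     (cong (_∷ []) (trans (regroup y l) (cong (λ w → l ℤ.+ w) (sym w≡r))))
  where
  l = least (s 1) u (+ a)
  regroup : ∀ y l → y ≡ l ℤ.+ (y ℤ.- l)
  regroup = ℤ.solve-∀
Admissible⇒Preimage s {suc m} {u} {a} hu (y ∷ z) (next , adm)
  with b , x , 0≤x , x<s , y≡ ← decompose (s 1) y = result y≡ b≡ (Admissible⇒Preimage (s ∘ suc) hv z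
    (subst (λ q → Admissible (s ∘ suc) q z) (trans v≡ (cong (λ b → ℚ.fromℤ b ℚ.- x ℚ./ s 1) b≡)) adm))
  where
  hv = /-InUnit (s 1) 0≤x x<s
  v≡ : y ℚ./ s 1 ≡ ℚ.fromℤ b ℚ.- x ℚ./ s 1
  v≡ = trans (cong (ℚ._/ s 1) y≡) (/-split (s 1) b x)
  b≡ : b ≡ + (a ℕ.+ jump u (x ℚ./ s 1))
  -- Both b and the running ascent count put the quotient into the same unit interval above a - u.
  b≡ = UnitAbove-unique {ℚ.fromℤ (+ a) ℚ.- u} {x ℚ./ s 1}
    (subst (UnitAbove (ℚ.fromℤ (+ a) ℚ.- u)) v≡ next) (UnitAbove-ascent hu hv a)
  result : y ≡ + s 1 ℤ.* b ℤ.- x → b ≡ + (a ℕ.+ jump u (x ℚ./ s 1)) →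
    Preimage (s ∘ suc) (x ℚ./ s 1) (a ℕ.+ jump u (x ℚ./ s 1)) z → Preimage s u a (y ∷ z)
  result refl refl (preimage {e} e∈I r<s refl) =
    preimage {e = x ∷ e} (λ { zero → 0≤x , x<s ; (suc i) → e∈I i }) r<s refl

-- Adding x + y to both sides gives x + b s = y + a s in ℕ, to be read modulo s. The multiples a and
-- b may differ, since in `point` they depend on the entry.
digit-unique : ∀ s {{_ : ℕ.NonZero s}} {a b x y} → 0ℤ ℤ.≤ x × x ℤ.< + s → 0ℤ ℤ.≤ y × y ℤ.< + s →
  + s ℤ.* + a ℤ.- x ≡ + s ℤ.* + b ℤ.- y → x ≡ y
digit-unique s {a} {b} {+ x} {+ y} (_ , +<+ x<s) (_ , +<+ y<s) eq = cong +_ (begin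
  x                        ≡⟨ ℕ.m<n⇒m%n≡m x<s ⟨
  x ℕ.% s                  ≡⟨ ℕ.[m+kn]%n≡m%n x b s ⟨
  (x ℕ.+ b ℕ.* s) ℕ.% s    ≡⟨ cong (ℕ._% s) (ℤ.+-injective moved) ⟩
  (y ℕ.+ a ℕ.* s) ℕ.% s    ≡⟨ ℕ.[m+kn]%n≡m%n y a s ⟩
  y ℕ.% s                  ≡⟨ ℕ.m<n⇒m%n≡m y<s ⟩
  y                        ∎)
  where
  open ≡-Reasoning
  regroup : ∀ x y b s → x ℤ.+ b ℤ.* s ≡ (s ℤ.* b ℤ.- y) ℤ.+ (x ℤ.+ y)
  regroup = ℤ.solve-∀
  regroup′ : ∀ x y a s → (s ℤ.* a ℤ.- x) ℤ.+ (x ℤ.+ y) ≡ y ℤ.+ a ℤ.* s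
  regroup′ = ℤ.solve-∀
  moved : + (x ℕ.+ b ℕ.* s) ≡ + (y ℕ.+ a ℕ.* s)
  moved = begin
    + x ℤ.+ + (b ℕ.* s)                       ≡⟨ cong (λ t → + x ℤ.+ t) (ℤ.pos-* b s) ⟩
    + x ℤ.+ + b ℤ.* + s                       ≡⟨ regroup (+ x) (+ y) (+ b) (+ s) ⟩
    (+ s ℤ.* + b ℤ.- + y) ℤ.+ (+ x ℤ.+ + y)   ≡⟨ cong (ℤ._+ (+ x ℤ.+ + y)) eq ⟨
    (+ s ℤ.* + a ℤ.- + x) ℤ.+ (+ x ℤ.+ + y)   ≡⟨ regroup′ (+ x) (+ y) (+ a) (+ s) ⟩
    + y ℤ.+ + a ℤ.* + s                       ≡⟨ cong (λ t → + y ℤ.+ t) (ℤ.pos-* a s) ⟨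
    + y ℤ.+ + (a ℕ.* s)                       ∎

-- Once the first entries agree, so do the parameters `u` and `a` passed to the tails.
point-injective : ∀ s {{_ : PositiveSequence s}} {m u a e f r t} →
  InversionSequence s m e → InversionSequence s m f →
  point s u a e r ≡ point s u a f t → e ≡ f × r ≡ t
point-injective s {u = u} {a} {[]} {[]} _ _ eq =
  refl , ℤ.+-injective (+-cancelˡ (least (s 1) u (+ a)) _ _ (Vec.∷-injectiveˡ eq))
point-injective s {u = u} {a} {x ∷ e} {y ∷ f} he hf eq
  with refl ← digit-unique (s 1) {a ℕ.+ jump u (x ℚ./ s 1)} {a ℕ.+ jump u (y ℚ./ s 1)}
                (he zero) (hf zero) (Vec.∷-injectiveˡ eq)
  with refl , r≡t ← point-injective (s ∘ suc) (he ∘ suc) (hf ∘ suc) (Vec.∷-injectiveʳ eq)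
  = refl , r≡t

-- Counting ascents and the last coordinate.

length-filter-tabulate : ∀ {R : Pred A p} (R? : Decidable R) {m} (f : Fin (suc m) → A) →
  length (filter R? (tabulate f)) ≡
  (if does (R? (f zero)) then 1 else 0) ℕ.+ length (filter R? (tabulate (f ∘ suc)))
length-filter-tabulate R? f with does (R? (f zero))
... | true  = refl
... | false = refl

-- A form of `asc` that recurses along with `point`, carrying the preceding quotient `u`.
ascents : ∀ s {{_ : PositiveSequence s}} {m} → ℚ → Vec ℤ m → ℕ
ascents s u []      = 0
ascents s u (x ∷ e) = jump u (x ℚ./ s 1) ℕ.+ ascents (s ∘ suc) (x ℚ./ s 1) e

-- The predicate and the enumeration `f` are arbitrary because the index set shifts at each step
-- while the tested vector stays fixed; only the Boolean outcomes matter.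
length-filter≡ascents : ∀ s {{_ : PositiveSequence s}} {m} x (e : Vec ℤ m)
  {R : Pred A p} (R? : Decidable R) (f : Fin m → A) →
  (∀ j → does (R? (f j)) ≡
         does (lookup (x ∷ e) (inject₁ j) ℚ./ s (suc (toℕ j)) ℚ.<? lookup e j ℚ./ s (suc (suc (toℕ j))))) →
  length (filter R? (tabulate f)) ≡ ascents (s ∘ suc) (x ℚ./ s 1) e
length-filter≡ascents s x []      R? f R≗ = refl
length-filter≡ascents s x (y ∷ e) R? f R≗ = trans (length-filter-tabulate R? f)
  (cong₂ ℕ._+_ (cong (if_then 1 else 0) (R≗ zero))
               (length-filter≡ascents (s ∘ suc) y e R? (f ∘ suc) (R≗ ∘ suc)))

asc≡ascents : ∀ s {{_ : PositiveSequence s}} {m} (e : Vec ℤ m) → asc s e ≡ ascents s 0ℚ e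
asc≡ascents s []              = refl
asc≡ascents s {suc m} (x ∷ e) = trans (length-filter-tabulate (ascent? s (x ∷ e)) {m} (λ i → i))
  (cong₂ ℕ._+_ (cong (if_then 1 else 0) (does-⇔ (0<⇔0</ (s 1) x) (0ℤ ℤ.<? x) (0ℚ ℚ.<? x ℚ./ s 1)))
               (length-filter≡ascents s x e (ascent? s (x ∷ e)) suc λ _ → refl))

-- The counter of `point` gains one `jump` per entry, so it reaches a + `ascents s u e` when `least`
-- is applied to the quotient of the last entry.
final-point : ∀ s {{_ : PositiveSequence s}} {k} u a (e : Vec ℤ (suc k)) r →
  final (point s u a e r) ≡
  + s (suc (suc k)) ℤ.* + (a ℕ.+ ascents s u e)
    ℤ.- floor ((+ s (suc (suc k)) ℤ.* final e) ℚ./ s (suc k)) ℤ.+ + r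
final-point s u a (x ∷ []) r = cong₂ (λ n f → + s 2 ℤ.* + n ℤ.- f ℤ.+ + r)
  (cong (a ℕ.+_) (sym (ℕ.+-identityʳ (jump u (x ℚ./ s 1)))))
  (cong floor (*-/ (s 1) (+ s 2) x))
final-point s {k = suc k} u a (x ∷ e@(_ ∷ _)) r = trans
  (final-point (s ∘ suc) (x ℚ./ s 1) (a ℕ.+ jump u (x ℚ./ s 1)) e r)
  (cong (λ n → + s (suc (suc (suc k))) ℤ.* + n
      ℤ.- floor ((+ s (suc (suc (suc k))) ℤ.* final e) ℚ./ s (suc (suc k))) ℤ.+ + r)
    (ℕ.+-assoc a (jump u (x ℚ./ s 1)) (ascents (s ∘ suc) (x ℚ./ s 1) e)))

final-point≡exponent : ∀ s {{_ : PositiveSequence s}} {k} (e : Vec ℤ (suc k)) r →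
  final (point s 0ℚ 0 e r) ≡ exponent s e ℤ.+ + r
final-point≡exponent s {k} e r = trans (final-point s 0ℚ 0 e r)
  (cong (λ n → + s (suc (suc k)) ℤ.* + n ℤ.- floor ((+ s (suc (suc k)) ℤ.* final e) ℚ./ s (suc k)) ℤ.+ + r)
    (sym (asc≡ascents s e)))

-- Laurent polynomials and enumerations.

coeff-↭ : ∀ {f g} → f ↭ g → f ≈ g
coeff-↭ ↭.refl k = refl
coeff-↭ (↭.prep (c , j) f↭g) k = cong (λ d → (if does (j ℤ.≟ k) then c else 0ℤ) ℤ.+ d) (coeff-↭ f↭g k)
coeff-↭ (↭.swap {xs = f} {ys = g} (c , i) (d , j) f↭g) k = begin
  x ℤ.+ (y ℤ.+ coeff f k)   ≡⟨ cong (λ t → x ℤ.+ (y ℤ.+ t)) (coeff-↭ f↭g k) ⟩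
  x ℤ.+ (y ℤ.+ coeff g k)   ≡⟨ exchange x y (coeff g k) ⟩
  y ℤ.+ (x ℤ.+ coeff g k)   ∎
  where
  open ≡-Reasoning
  exchange : ∀ x y t → x ℤ.+ (y ℤ.+ t) ≡ y ℤ.+ (x ℤ.+ t)
  exchange = ℤ.solve-∀
  x = if does (i ℤ.≟ k) then c else 0ℤ
  y = if does (j ℤ.≟ k) then d else 0ℤ
coeff-↭ (↭.trans f↭g g↭h) k = trans (coeff-↭ f↭g k) (coeff-↭ g↭h k)

·-[1] : ∀ f → f · [ 1 ] ≡ f
·-[1] []            = refl
·-[1] ((c , j) ∷ f) = cong₂ _∷_ (cong₂ _,_ (ℤ.*-identityʳ c) (ℤ.+-identityʳ j)) (·-[1] f)

-- Since `_·_` is itself a `cartesianProductWith`, this factors a generating function over pairs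
-- whose exponent is a sum.
map-cartesianProductWith : ∀ {f : A → B → D} {h : D → D′} {g : A′ → B′ → D′} {k : A → A′} {l : B → B′} →
  (∀ x y → h (f x y) ≡ g (k x) (l y)) → ∀ xs ys →
  List.map h (cartesianProductWith f xs ys) ≡ cartesianProductWith g (List.map k xs) (List.map l ys)
map-cartesianProductWith hf≡gkl []       ys = refl
map-cartesianProductWith {f = f} {h} {g} {k} {l} hf≡gkl (x ∷ xs) ys = begin
  List.map h (List.map (f x) ys ++ cartesianProductWith f xs ys)
    ≡⟨ List.map-++ h (List.map (f x) ys) (cartesianProductWith f xs ys) ⟩
  List.map h (List.map (f x) ys) ++ List.map h (cartesianProductWith f xs ys)
    ≡⟨ cong₂ _++_ (trans (sym (List.map-∘ ys)) (trans (List.map-cong (hf≡gkl x) ys) (List.map-∘ ys)))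
                  (map-cartesianProductWith hf≡gkl xs ys) ⟩
  List.map (g (k x)) (List.map l ys) ++ cartesianProductWith g (List.map k xs) (List.map l ys) ∎
  where open ≡-Reasoning

-- Injectivity is asked only on members of `xs`, matching `point-injective`, which concerns
-- inversion sequences.
cartesianProductWith-unique : ∀ {f : A → B → D} {xs ys} → Unique xs → Unique ys →
  (∀ {w x y z} → w ∈ xs → x ∈ xs → f w y ≡ f x z → w ≡ x × y ≡ z) →
  Unique (cartesianProductWith f xs ys)
cartesianProductWith-unique [] ys! f-inj = []
cartesianProductWith-unique {f = f} {x ∷ xs} {ys} (x∉xs ∷ xs!) ys! f-inj = Unique.++⁺
  (Unique.map⁺ (λ eq → proj₂ (f-inj (here refl) (here refl) eq)) ys!)
  (cartesianProductWith-unique xs! ys! λ w∈ x∈ → f-inj (there w∈) (there x∈))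
  disjoint
  where
  disjoint : ∀ {v} → v ∈ List.map (f x) ys × v ∈ cartesianProductWith f xs ys → _
  disjoint (v∈ , v∈′) with _ , _ , v≡ ← ∈-map⁻ (f x) v∈
    with w , _ , w∈ , _ , v≡′ ← ∈-cartesianProductWith⁻ f xs ys v∈′ =
    All.lookup x∉xs w∈ (proj₁ (f-inj (here refl) (there w∈) (trans (sym v≡) v≡′)))

-- Duplicate-free lists with the same members are equal as bags. This makes Q independent of the
-- chosen enumeration.
elements-↭ : ∀ {S : Pred A p} (F G : Finite S) → elements F ↭ elements G
elements-↭ F G = ∼bag⇒↭ (unique∧set⇒bag (unique F) (unique G)
  (⇔.trans (∈-elements F) (⇔.sym (∈-elements G))))

-- The lattice points of Π and their generating function.

InUnit-0 : InUnit 0ℚ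
InUnit-0 = ℚ.≤-refl , ℚ.positive⁻¹ 1ℚ

module _ (s : ℕ → ℕ) {{_ : PositiveSequence s}} (m : ℕ) where
  private
    I = InversionSequence-finite s m
    points = cartesianProductWith (point s 0ℚ 0) (elements I) (upTo (s (suc m)))

    ∈-points⇔Preimage : ∀ {z : Vec ℤ (suc m)} → z ∈ points ⇔ Preimage s 0ℚ 0 z
    ∈-points⇔Preimage = mk⇔ ⇒ ⇐
      where
      ⇒ : ∀ {z : Vec ℤ (suc m)} → z ∈ points → Preimage s 0ℚ 0 z
      ⇒ z∈ with _ , _ , e∈ , r∈ , z≡ ← ∈-cartesianProductWith⁻ (point s 0ℚ 0) (elements I) (upTo (s (suc m))) z∈ =
        preimage (to (∈-elements I) e∈) (∈-upTo⁻ r∈) z≡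
      ⇐ : ∀ {z : Vec ℤ (suc m)} → Preimage s 0ℚ 0 z → z ∈ points
      ⇐ (preimage e∈I r<s refl) =
        ∈-cartesianProductWith⁺ (point s 0ℚ 0) (from (∈-elements I) e∈I) (∈-upTo⁺ r<s)

    Preimage⇔Admissible : ∀ {z : Vec ℤ (suc m)} → Preimage s 0ℚ 0 z ⇔ Admissible s 0ℚ z
    Preimage⇔Admissible {z} = mk⇔
      (λ (preimage {e} {r} e∈I r<s z≡) → subst₂ (λ q z → Admissible s q z) 0-0≡0 (sym z≡)
        (point-admissible s {u = 0ℚ} {0} {e} {r} InUnit-0 e∈I r<s))
      (λ adm → Admissible⇒Preimage s {u = 0ℚ} {0} InUnit-0 z (subst (λ q → Admissible s q z) (sym 0-0≡0) adm))
      where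
      -- The recursion starts at a = 0 and u = 0, so a - u is the conventional quotient z₀/s₀ = 0.
      0-0≡0 : ℚ.fromℤ (+ 0) ℚ.- 0ℚ ≡ 0ℚ
      0-0≡0 = ℚ.+-identityʳ 0ℚ

  LatticePoint-finite : Finite (LatticePoint s (suc m))
  LatticePoint-finite = record
    { elements   = points
    ; unique     = cartesianProductWith-unique (unique I) (Unique.upTo⁺ (s (suc m)))
                     λ {e} {f} {r} {t} e∈ f∈ → point-injective s {u = 0ℚ} {0} {e} {f} {r} {t}
                       (to (∈-elements I) e∈) (to (∈-elements I) f∈)
    ; ∈-elements = λ {z} → ⇔.trans ∈-points⇔Preimage (⇔.trans Preimage⇔Admissible (⇔.sym (LatticePoint⇔Admissible s z)))
    }

theorem4p1 : (s : ℕ → ℕ) {{_ : PositiveSequence s}} (k : ℕ) →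
    Finite (LatticePoint s (suc (suc k))) ×
    ((Π-finite : Finite (LatticePoint s (suc (suc k)))) →
    P s (suc k) Π-finite ≃ fromLaurent (∑x^ (InversionSequence-finite s (suc k)) (exponent s)))
theorem4p1 s k = LatticePoint-finite s (suc k) , λ Π-finite i → begin
  coeff (Q s (suc k) Π-finite · [ 1 ]) i
    ≡⟨ cong (λ f → coeff f i) (·-[1] (Q s (suc k) Π-finite)) ⟩
  coeff (Q s (suc k) Π-finite) i
    ≡⟨ coeff-↭ (map⁺ (λ z → x^ final z) (elements-↭ Π-finite (LatticePoint-finite s (suc k)))) i ⟩
  coeff (Q s (suc k) (LatticePoint-finite s (suc k))) i
    -- The last coordinate is `exponent s e` plus the offset r, and r ranges over 0, ..., sₙ - 1,
    -- which yields the factor cancelled by the denominator of P.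
    ≡⟨ cong (λ f → coeff f i) (map-cartesianProductWith (λ e r → cong x^_ (final-point≡exponent s e r))
         (elements (InversionSequence-finite s (suc k))) (upTo (s (suc (suc k))))) ⟩
  coeff (∑x^ (InversionSequence-finite s (suc k)) (exponent s) · [ s (suc (suc k)) ]) i ∎
  where open ≡-Reasoning
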